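{- Let $G$ be a graph and let $\mathcal{H}=\{H_j\}_{j\in J}$ be a finite family of connected nonnull subgraphs of $G$. Then $\mathsf{tree}\text{ - }\alpha(G(\mathcal{H}))\le \mathsf{tree}\text{ - }\alpha(G)$.
   Context: All graphs are finite, simple, and undirected; a graph is nonnull if it has at least one vertex. For a graph $G$ and a family $\mathcal{H}=\{H_j\}_{j\in J}$ of connected subgraphs of $G$, the graph $G(\mathcal{H})$ has vertex set $J$, and two distinct elements $i,j\in J$ are adjacent if and only if $H_i$ and $H_j$ have a vertex in common or there is an edge of $G$ with one endpoint in $H_i$ and the other in $H_j$. A tree decomposition of a graph $G$ is a pair $\mathcal{T}=(T,\{X_t\}_{t\in V(T)})$ where $T$ is a tree and each node $t$ is assigned a bag $X_t\subseteq V(G)$ such that every vertex of $G$ is in at least one bag, every edge of $G$ has both endpoints in some common bag, and for every $u\in V(G)$ the subgraph of $T$ induced by $\{t: u\in X_t\}$ is connected. The independence number of $\mathcal{T}$ is $\alpha(\mathcal{T})=\max_{t\in V(T)}\alpha(G[X_t])$, where $\alpha(H)$ is the maximum size of an independent set in $H$. The tree-independence number $\mathsf{tree}\text{ - }\alpha(G)$ is the minimum of $\alpha(\mathcal{T})$ over all tree decompositions $\mathcal{T}$ of $G$. -}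

module Defs where

open import Level using (0ℓ)
open import Data.Nat using (ℕ; zero; suc; _≤_; NonZero)
open import Data.Nat.Properties using (≤-antisym; ≮⇒≥)
open import Data.Nat.Induction using (<-rec)
open import Data.Fin using (Fin; zero; suc)
open import Data.Fin.Properties using (_≟_; any?; all?)
open import Data.Fin.Subset using (Subset; Nonempty; _∈_; _⊆_; ⊤; ∣_∣; inside; outside)
open import Data.Fin.Subset.Properties using (_∈?_; _⊆?_; ∈⊤)
open import Data.List using (List; []; _∷_; [_]; _++_; _∷ʳ_; length; map; filter; allFin)
open import Data.List.Extrema.Nat using (max)
open import Data.List.Relation.Unary.Linked using (Linked; _∷_)
open import Data.List.Relation.Unary.Unique.Propositional using (Unique)
open import Data.Vec using ([]; _∷_; tabulate; lookup)
open import Data.Empty using (⊥)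
open import Data.Product using (_×_; _,_; ∃-syntax)
open import Data.Sum using (_⊎_; inj₁; inj₂)
open import Function using (_∘_; id)
open import Relation.Nullary using (¬_; Dec; no)
open import Relation.Nullary.Decidable using (_×-dec_; _⊎-dec_; _→-dec_; ¬?)
open import Relation.Binary using (Rel; Decidable; Symmetric; Irreflexive)
open import Relation.Binary.Construct.Closure.ReflexiveTransitive using (Star; ε)
open import Relation.Binary.PropositionalEquality using (_≡_; _≢_; refl; sym)

record Graph (n : ℕ) : Set₁ where
  field
    Adj        : Rel (Fin n) 0ℓ
    adj?       : Decidable Adj
    adj-sym    : Symmetric Adj
    adj-irrefl : Irreflexive _≡_ Adj

open Graph public

record Subgraph {n : ℕ} (G : Graph n) : Set₁ where
  field
    verts    : Subset n
    Edge     : Rel (Fin n) 0ℓ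
    edge?    : Decidable Edge
    edge-sym : Symmetric Edge
    edge⇒adj : ∀ {u v} → Edge u v → Adj G u v
    edge⇒∈   : ∀ {u v} → Edge u v → u ∈ verts

open Subgraph public

induced : ∀ {n} (G : Graph n) → Subset n → Subgraph G
induced G X = record
  { verts    = X
  ; Edge     = λ u v → u ∈ X × v ∈ X × Adj G u v
  ; edge?    = λ u v → (u ∈? X) ×-dec ((v ∈? X) ×-dec adj? G u v)
  ; edge-sym = λ (p , q , e) → q , p , adj-sym G e
  ; edge⇒adj = λ (_ , _ , e) → e
  ; edge⇒∈   = λ (p , _ , _) → p
  }

-- The null subgraph counts as connected.
Connected : ∀ {n} {G : Graph n} → Subgraph G → Set
Connected H = ∀ {u v} → u ∈ verts H → v ∈ verts H → Star (Edge H) u v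

Nonnull : ∀ {n} {G : Graph n} → Subgraph G → Set
Nonnull H = Nonempty (verts H)

-- The graph G(𝓗).
module _ {n m : ℕ} (G : Graph n) (H : Fin m → Subgraph G) where

  Meet : Rel (Fin m) 0ℓ
  Meet i j = ∃[ v ] (v ∈ verts (H i) × v ∈ verts (H j))

  Joined : Rel (Fin m) 0ℓ
  Joined i j = ∃[ u ] ∃[ v ] (u ∈ verts (H i) × v ∈ verts (H j) × Adj G u v)

  familyGraph : Graph m
  familyGraph = record
    { Adj        = λ i j → i ≢ j × (Meet i j ⊎ Joined i j)
    ; adj?       = λ i j → ¬? (i ≟ j) ×-dec (meet? i j ⊎-dec joined? i j)
    ; adj-sym    = λ
        { (i≢j , inj₁ (v , p , q))         → i≢j ∘ sym , inj₁ (v , q , p)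
        ; (i≢j , inj₂ (u , v , p , q , e)) → i≢j ∘ sym , inj₂ (v , u , q , p , adj-sym G e)
        }
    ; adj-irrefl = λ i≡j (i≢j , _) → i≢j i≡j
    }
    where
    meet? : Decidable Meet
    meet? i j = any? λ v → (v ∈? verts (H i)) ×-dec (v ∈? verts (H j))

    joined? : Decidable Joined
    joined? i j = any? λ u → any? λ v →
      (u ∈? verts (H i)) ×-dec ((v ∈? verts (H j)) ×-dec adj? G u v)

-- v ∷ vs lists the distinct vertices of the cycle in cyclic order.
IsCycle : ∀ {n} → Graph n → Fin n → List (Fin n) → Set
IsCycle G v vs = 2 ≤ length vs × Unique (v ∷ vs) × Linked (Adj G) (v ∷ vs ∷ʳ v)

record IsTree {n : ℕ} (T : Graph n) : Set where
  field
    nonnull   : NonZero n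
    connected : Connected (induced T ⊤)
    acyclic   : ∀ v vs → ¬ IsCycle T v vs

record TreeDecomposition {n : ℕ} (G : Graph n) : Set₁ where
  field
    {nodes} : ℕ
    tree    : Graph nodes
    isTree  : IsTree tree
    bag     : Fin nodes → Subset n

  nodesContaining : Fin n → Subset nodes
  nodesContaining u = tabulate λ t → lookup (bag t) u

  field
    vertex-covered : ∀ u → ∃[ t ] u ∈ bag t
    edge-covered   : ∀ {u v} → Adj G u v → ∃[ t ] (u ∈ bag t × v ∈ bag t)
    bags-connected : ∀ u → Connected (induced tree (nodesContaining u))

open TreeDecomposition public

Independent : ∀ {n} {G : Graph n} → Subgraph G → Subset n → Set
Independent H S = S ⊆ verts H × (∀ u v → u ∈ S → v ∈ S → ¬ Edge H u v)

independent? : ∀ {n} {G : Graph n} (H : Subgraph G) (S : Subset n) → Dec (Independent H S)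
independent? H S = (S ⊆? verts H) ×-dec
  all? λ u → all? λ v → (u ∈? S) →-dec ((v ∈? S) →-dec ¬? (edge? H u v))

subsets : ∀ n → List (Subset n)
subsets zero    = [ [] ]
subsets (suc n) = map (inside ∷_) (subsets n) ++ map (outside ∷_) (subsets n)

α : ∀ {n} {G : Graph n} → Subgraph G → ℕ
α {n} H = max 0 (map ∣_∣ (filter (independent? H) (subsets n)))

-- The default 0 never matters, since a tree has at least one node.
αᵀ : ∀ {n} {G : Graph n} → TreeDecomposition G → ℕ
αᵀ {G = G} 𝒯 = max 0 (map (λ t → α (induced G (bag 𝒯 t))) (allFin (nodes 𝒯)))

-- k is tree-α(G), the minimum of α(𝒯) over all tree decompositions 𝒯 of G.
-- As there are infinitely many of these, the minimum is given by its graph;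
-- it is unique and (classically) exists, see below.
record IsTreeα {n : ℕ} (G : Graph n) (k : ℕ) : Set₁ where
  field
    attained : ∃[ 𝒯 ] αᵀ {G = G} 𝒯 ≡ k
    minimal  : (𝒯 : TreeDecomposition G) → k ≤ αᵀ 𝒯

open IsTreeα public

IsTreeα-unique : ∀ {n} {G : Graph n} {k l} → IsTreeα G k → IsTreeα G l → k ≡ l
IsTreeα-unique record { attained = 𝒮 , refl ; minimal = p }
               record { attained = 𝒯 , refl ; minimal = q } = ≤-antisym (p 𝒯) (q 𝒮)

trivialDecomposition : ∀ {n} (G : Graph n) → TreeDecomposition G
trivialDecomposition G = record
  { tree           = point
  ; isTree         = record
    { nonnull   = _
    ; connected = λ { {zero} {zero} _ _ → ε }
    ; acyclic   = λ { _ [] (() , _) ; _ (_ ∷ _) (_ , _ , () ∷ _) }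
    }
  ; bag            = λ _ → ⊤
  ; vertex-covered = λ _ → zero , ∈⊤
  ; edge-covered   = λ _ → zero , ∈⊤ , ∈⊤
  ; bags-connected = λ { _ {zero} {zero} _ _ → ε }
  }
  where
  point : Graph 1
  point = record
    { Adj = λ _ _ → ⊥ ; adj? = λ _ _ → no id ; adj-sym = id ; adj-irrefl = λ _ () }

IsTreeα-exists : ∀ {n} (G : Graph n) → ¬ ¬ (∃[ k ] IsTreeα G k)
IsTreeα-exists G none = noValue _ (trivialDecomposition G) refl
  where
  noValue : ∀ k (𝒯 : TreeDecomposition G) → αᵀ 𝒯 ≢ k
  noValue = <-rec _ λ k smaller 𝒯 eq → none (k , record
    { attained = 𝒯 , eq
    ; minimal  = λ 𝒮 → ≮⇒≥ λ lt → smaller lt 𝒮 refl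
    })

{-# OPTIONS --safe #-}

-- Given a tree decomposition (T, {X_t}) of G, keep T and let the bag of t
-- consist of all j such that H_j meets X_t.  The nodes whose bag contains j form
-- a union of subtrees of T, one for each vertex of H_j; adjacent vertices have
-- intersecting subtrees, so connectedness of H_j makes the union connected.
-- An independent set of G(𝓗) inside the bag of t becomes, on picking a vertex
-- of H_j ∩ X_t for each of its members j, an independent set of G[X_t] of the
-- same size.
module Submission where

open import Defs
open import Data.Nat using (ℕ; suc; _≤_; z≤n; s≤s)
open import Data.Nat.Properties using (≤-trans; module ≤-Reasoning)
open import Data.Fin using (Fin; zero; suc)
open import Data.Fin.Properties using (_≟_; any?; suc-injective)
open import Data.Fin.Subset using (Subset; Nonempty; _∈_; _∩_; _-_; ∣_∣; inside; outside)
open import Data.Fin.Subset.Properties using (_∈?_; nonempty?; x∈p∩q⁺; x∈p∩q⁻; x∈p⇒∣p-x∣<∣p∣; x∈p∧x≢y⇒x∈p-y)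
open import Data.List using (map; allFin)
open import Data.List.Extrema.Nat using (xs≤max; max≤v⁺)
open import Data.List.Membership.Propositional using () renaming (_∈_ to _∈ₗ_)
open import Data.List.Membership.Propositional.Properties using (∈-map⁺; ∈-++⁺ˡ; ∈-++⁺ʳ; ∈-filter⁺; ∈-allFin)
open import Data.List.Relation.Unary.All as All using (universal; lookup)
open import Data.List.Relation.Unary.All.Properties using (map⁺; all-filter)
open import Data.List.Relation.Unary.Any using (here)
open import Data.Product using (_×_; _,_; proj₁; proj₂; ∃-syntax)
open import Data.Sum using (inj₁; inj₂)
open import Data.Vec as Vec using ([]; _∷_; tabulate; here; there)
open import Data.Vec.Properties using ([]=⇒lookup; lookup⇒[]=; lookup∘tabulate)
open import Function using (_∘_)
open import Relation.Nullary using (¬_; Dec; does; yes; no; contradiction)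
open import Relation.Nullary.Decidable using (_×-dec_; dec-true; decidable-stable)
open import Relation.Unary using (Pred; Decidable)
open import Relation.Binary.Construct.Closure.ReflexiveTransitive using (Star; ε; _◅_; _◅◅_) renaming (map to mapStar)
open import Relation.Binary.PropositionalEquality using (_≡_; _≢_; refl; sym; trans; cong)

does-true⇒ : ∀ {a} {A : Set a} (a? : Dec A) → does a? ≡ inside → A
does-true⇒ (yes a) _ = a

module _ {n p} {P : Pred (Fin n) p} (P? : Decidable P) where

  comprehension : Subset n
  comprehension = tabulate (does ∘ P?)

  ∈-comprehension⁺ : ∀ {x} → P x → x ∈ comprehension
  ∈-comprehension⁺ {x} px =
    lookup⇒[]= x _ (trans (lookup∘tabulate _ x) (dec-true (P? x) px))

  ∈-comprehension⁻ : ∀ {x} → x ∈ comprehension → P x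
  ∈-comprehension⁻ {x} x∈ =
    does-true⇒ (P? x) (trans (sym (lookup∘tabulate _ x)) ([]=⇒lookup x∈))

-- Induction on `p`. When `zero` is in `p`, its image `f zero` is deleted from `q`, which lowers the
-- size by at least one; injectivity keeps the other images off `f zero`.
injection⇒∣p∣≤∣q∣ : ∀ {m n} (p : Subset m) (q : Subset n) (f : Fin m → Fin n) →
  (∀ {i} → i ∈ p → f i ∈ q) →
  (∀ {i j} → i ∈ p → j ∈ p → f i ≡ f j → i ≡ j) →
  ∣ p ∣ ≤ ∣ q ∣
injection⇒∣p∣≤∣q∣ []            q f into inj = z≤n
injection⇒∣p∣≤∣q∣ (outside ∷ p) q f into inj =
  injection⇒∣p∣≤∣q∣ p q (f ∘ suc) (into ∘ there)
    λ i∈p j∈p → suc-injective ∘ inj (there i∈p) (there j∈p)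
injection⇒∣p∣≤∣q∣ (inside ∷ p) q f into inj = begin
  suc ∣ p ∣          ≤⟨ s≤s rest ⟩
  suc ∣ q - f zero ∣ ≤⟨ x∈p⇒∣p-x∣<∣p∣ (into here) ⟩
  ∣ q ∣              ∎
  where
  open ≤-Reasoning

  f[1+i]≢f0 : ∀ {i} → i ∈ p → f (suc i) ≢ f zero
  f[1+i]≢f0 i∈p eq = contradiction (inj (there i∈p) here eq) λ ()

  rest : ∣ p ∣ ≤ ∣ q - f zero ∣
  rest = injection⇒∣p∣≤∣q∣ p (q - f zero) (f ∘ suc)
    (λ i∈p → x∈p∧x≢y⇒x∈p-y (into (there i∈p)) (f[1+i]≢f0 i∈p))
    (λ i∈p j∈p → suc-injective ∘ inj (there i∈p) (there j∈p))

∈-subsets : ∀ {n} (S : Subset n) → S ∈ₗ subsets n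
∈-subsets []            = here refl
∈-subsets (inside  ∷ S) = ∈-++⁺ˡ (∈-map⁺ (inside ∷_) (∈-subsets S))
∈-subsets (outside ∷ S) = ∈-++⁺ʳ (map (inside ∷_) (subsets _)) (∈-map⁺ (outside ∷_) (∈-subsets S))

module _ {n} {G : Graph n} (K : Subgraph G) where

  -- Together with `α-lub` this is the universal property of the maximum, which replaces the
  -- enumeration of all subsets from here on.
  independent⇒∣S∣≤α : ∀ {S} → Independent K S → ∣ S ∣ ≤ α K
  independent⇒∣S∣≤α {S} ind =
    lookup (xs≤max 0 _) (∈-map⁺ ∣_∣ (∈-filter⁺ (independent? K) (∈-subsets S) ind))

  α-lub : ∀ {k} → (∀ {S} → Independent K S → ∣ S ∣ ≤ k) → α K ≤ k
  α-lub bound = max≤v⁺ z≤n (map⁺ (All.map bound (all-filter (independent? K) (subsets n))))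

module _ {n} {G : Graph n} (𝒯 : TreeDecomposition G) where

  α-bag≤αᵀ : ∀ t → α (induced G (bag 𝒯 t)) ≤ αᵀ 𝒯
  α-bag≤αᵀ t = lookup (xs≤max 0 _) (∈-map⁺ _ (∈-allFin t))

  αᵀ-lub : ∀ {k} → (∀ t → α (induced G (bag 𝒯 t)) ≤ k) → αᵀ 𝒯 ≤ k
  αᵀ-lub bound = max≤v⁺ z≤n (map⁺ (universal bound (allFin (nodes 𝒯))))

module _ {n k} (X : Fin k → Subset n) where

  -- Unfolds to the same term as `nodesContaining`, but takes only the bags, so it also serves a
  -- decomposition still being built.
  indicesContaining : Fin n → Subset k
  indicesContaining u = tabulate λ t → Vec.lookup (X t) u

  ∈-indicesContaining⁺ : ∀ {u t} → u ∈ X t → t ∈ indicesContaining u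
  ∈-indicesContaining⁺ {t = t} u∈ =
    lookup⇒[]= t _ (trans (lookup∘tabulate _ t) ([]=⇒lookup u∈))

  ∈-indicesContaining⁻ : ∀ {u t} → t ∈ indicesContaining u → u ∈ X t
  ∈-indicesContaining⁻ {u} {t} t∈ =
    lookup⇒[]= u _ (trans (sym (lookup∘tabulate _ t)) ([]=⇒lookup t∈))

module _ {n m} (G : Graph n) (H : Fin m → Subgraph G)
         (H-connected : ∀ j → Connected (H j)) (H-nonnull : ∀ j → Nonnull (H j)) where

  Hits : Subset n → Pred (Fin m) _
  Hits X j = Nonempty (verts (H j) ∩ X)

  hits? : ∀ X → Decidable (Hits X)
  hits? X j = nonempty? (verts (H j) ∩ X)

  hitting : Subset n → Subset m
  hitting X = comprehension (hits? X)

  ∈-hitting⁺ : ∀ {X j v} → v ∈ verts (H j) → v ∈ X → j ∈ hitting X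
  ∈-hitting⁺ {X} v∈H v∈X = ∈-comprehension⁺ (hits? X) (_ , x∈p∩q⁺ (v∈H , v∈X))

  ∈-hitting⁻ : ∀ {X j} → j ∈ hitting X → ∃[ v ] (v ∈ verts (H j) × v ∈ X)
  ∈-hitting⁻ {X} j∈ =
    let v , v∈ = ∈-comprehension⁻ (hits? X) j∈ in v , x∈p∩q⁻ _ _ v∈

  -- Outside hitting X the value is an arbitrary vertex of H j.
  representative : Subset n → Fin m → Fin n
  representative X j with hits? X j
  ... | yes (v , _) = v
  ... | no  _       = proj₁ (H-nonnull j)

  representative-∈ : ∀ X {j} → j ∈ hitting X →
    representative X j ∈ verts (H j) × representative X j ∈ X
  representative-∈ X {j} j∈ with hits? X j
  ... | yes (_ , v∈) = x∈p∩q⁻ _ _ v∈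
  ... | no  ¬hit     = contradiction (∈-comprehension⁻ (hits? X) j∈) ¬hit

  -- For distinct members of an independent `S`, equal representatives would make the two subgraphs
  -- meet, and adjacent ones would make them joined. So `S` injects into an independent set of G[X].
  α-hitting≤α : ∀ X → α (induced (familyGraph G H) (hitting X)) ≤ α (induced G X)
  α-hitting≤α X = α-lub (induced (familyGraph G H) (hitting X)) bound
    where
    bound : ∀ {S} → Independent (induced (familyGraph G H) (hitting X)) S → ∣ S ∣ ≤ α (induced G X)
    bound {S} (S⊆ , nonadj) = ≤-trans
      (injection⇒∣p∣≤∣q∣ S image rep rep∈image rep-injective)
      (independent⇒∣S∣≤α (induced G X) (image⊆X , image-nonadj))
      where
      rep : Fin m → Fin n
      rep = representative X

      rep∈H : ∀ {i} → i ∈ S → rep i ∈ verts (H i)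
      rep∈H = proj₁ ∘ representative-∈ X ∘ S⊆

      image? : Decidable λ v → ∃[ j ] (j ∈ S × rep j ≡ v)
      image? v = any? λ j → (j ∈? S) ×-dec (rep j ≟ v)

      image : Subset n
      image = comprehension image?

      rep∈image : ∀ {i} → i ∈ S → rep i ∈ image
      rep∈image i∈S = ∈-comprehension⁺ image? (_ , i∈S , refl)

      -- Adjacency in G(𝓗) includes `i ≢ j`, so that much is assumed; independence of `S` refutes
      -- it, and equality on `Fin m` is decidable.
      adjacent-if-≢⇒≡ : ∀ {i j} → i ∈ S → j ∈ S →
        (i ≢ j → Adj (familyGraph G H) i j) → i ≡ j
      adjacent-if-≢⇒≡ {i} {j} i∈S j∈S adj = decidable-stable (i ≟ j) λ i≢j →
        nonadj i j i∈S j∈S (S⊆ i∈S , S⊆ j∈S , adj i≢j)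

      rep-injective : ∀ {i j} → i ∈ S → j ∈ S → rep i ≡ rep j → i ≡ j
      -- Binding `r` before the rewrite turns its type into `rep j ∈ verts (H i)`, so `rep j` is a
      -- common vertex.
      rep-injective {i} {j} i∈S j∈S eq with r ← rep∈H i∈S rewrite eq =
        adjacent-if-≢⇒≡ i∈S j∈S λ i≢j → i≢j , inj₁ (rep j , r , rep∈H j∈S)

      image⊆X : ∀ {v} → v ∈ image → v ∈ X
      image⊆X v∈ with _ , j∈S , refl ← ∈-comprehension⁻ image? v∈ =
        proj₂ (representative-∈ X (S⊆ j∈S))

      image-nonadj : ∀ u v → u ∈ image → v ∈ image → ¬ Edge (induced G X) u v
      image-nonadj u v u∈ v∈ (_ , _ , adj)
        with i , i∈S , refl ← ∈-comprehension⁻ image? u∈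
           | j , j∈S , refl ← ∈-comprehension⁻ image? v∈ =
        -- The edge joins `H i` to `H j`, which forces `i ≡ j` and makes the edge a loop.
        adj-irrefl G (cong rep i≡j) adj
        where
        i≡j : i ≡ j
        i≡j = adjacent-if-≢⇒≡ i∈S j∈S λ i≢j →
          i≢j , inj₂ (rep i , rep j , rep∈H i∈S , rep∈H j∈S , adj)

  module _ (𝒯 : TreeDecomposition G) where

    private
      familyBag : Fin (nodes 𝒯) → Subset m
      familyBag t = hitting (bag 𝒯 t)

      BothHit : Fin m → Fin (nodes 𝒯) → Fin (nodes 𝒯) → Set
      BothHit j s t = j ∈ familyBag s × j ∈ familyBag t × Adj (tree 𝒯) s t

      -- The nodes whose bags contain `u` are connected in the tree, and `H j` hits each of those
      -- bags at `u`.
      within-vertex : ∀ {j u s t} → u ∈ verts (H j) → u ∈ bag 𝒯 s → u ∈ bag 𝒯 t →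
        Star (BothHit j) s t
      within-vertex {u = u} u∈H u∈s u∈t = mapStar
        (λ (p , q , e) → ∈-hitting⁺ u∈H (∈-indicesContaining⁻ (bag 𝒯) p) , ∈-hitting⁺ u∈H (∈-indicesContaining⁻ (bag 𝒯) q) , e)
        (bags-connected 𝒯 u (∈-indicesContaining⁺ (bag 𝒯) u∈s) (∈-indicesContaining⁺ (bag 𝒯) u∈t))

      -- Induction on the walk in `H j`: a bag `r` covering the first edge lies in the subtrees of
      -- both its ends, so one can pass from one subtree to the next.
      along-path : ∀ {j u v s t} → Star (Edge (H j)) u v → u ∈ verts (H j) →
        u ∈ bag 𝒯 s → v ∈ bag 𝒯 t → Star (BothHit j) s t
      along-path ε u∈H u∈s v∈t = within-vertex u∈H u∈s v∈t
      along-path {j} (e ◅ es) u∈H u∈s v∈t =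
        let r , u∈r , w∈r = edge-covered 𝒯 (edge⇒adj (H j) e)
        in within-vertex u∈H u∈s u∈r ◅◅ along-path es (edge⇒∈ (H j) (edge-sym (H j) e)) w∈r v∈t

    familyDecomposition : TreeDecomposition (familyGraph G H)
    familyDecomposition = record
      { tree           = tree 𝒯
      ; isTree         = isTree 𝒯
      ; bag            = familyBag
      ; vertex-covered = λ j →
          let v , v∈H = H-nonnull j
              t , v∈t = vertex-covered 𝒯 v
          in t , ∈-hitting⁺ v∈H v∈t
      ; edge-covered   = λ
          { (_ , inj₁ (v , v∈Hi , v∈Hj)) →
              let t , v∈t = vertex-covered 𝒯 v
              in t , ∈-hitting⁺ v∈Hi v∈t , ∈-hitting⁺ v∈Hj v∈t
          ; (_ , inj₂ (u , v , u∈Hi , v∈Hj , adj)) →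
              let t , u∈t , v∈t = edge-covered 𝒯 adj
              in t , ∈-hitting⁺ u∈Hi u∈t , ∈-hitting⁺ v∈Hj v∈t
          }
      -- `H j` may hit the two bags at different vertices `u` and `v`; a walk between them in `H j`
      -- is lifted to the tree.
      ; bags-connected = λ j {s} {t} s∈ t∈ →
          let u , u∈H , u∈s = ∈-hitting⁻ (∈-indicesContaining⁻ familyBag s∈)
              v , v∈H , v∈t = ∈-hitting⁻ (∈-indicesContaining⁻ familyBag t∈)
          in mapStar (λ (p , q , e) → ∈-indicesContaining⁺ familyBag p , ∈-indicesContaining⁺ familyBag q , e)
               (along-path (H-connected j u∈H v∈H) u∈H u∈s v∈t)
      }

    αᵀ-familyDecomposition : αᵀ familyDecomposition ≤ αᵀ 𝒯
    αᵀ-familyDecomposition = αᵀ-lub familyDecomposition λ t →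
      ≤-trans (α-hitting≤α (bag 𝒯 t)) (α-bag≤αᵀ 𝒯 t)

theorem6p2 : ∀ {n m : ℕ} (G : Graph n) (H : Fin m → Subgraph G) →
    (∀ j → Connected (H j)) →
    (∀ j → Nonnull (H j)) →
    ∀ {a b : ℕ} → IsTreeα (familyGraph G H) a → IsTreeα G b → a ≤ b
theorem6p2 G H conn nonnull record { minimal = minimal } record { attained = 𝒯 , refl } =
  -- Here `𝒯` is an optimal decomposition of `G`, so `αᵀ 𝒯` stands for `b`.
  ≤-trans (minimal (familyDecomposition G H conn nonnull 𝒯))
          (αᵀ-familyDecomposition G H conn nonnull 𝒯)
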